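{- Let $q$ be a prime power and let $\gamma\in\mathbb{F}_q^*$. Let $W^0_\gamma=\{(x,x^q+\gamma h): x\in\mathbb{F}_{q^5},\ \mathrm{Tr}_{q^5/q}(x)=0,\ h\in\mathbb{F}_q\}$, $W^1_\gamma=\{(x,x^q+\gamma\,\mathrm{Tr}_{q^5/q}(x)): x\in\mathbb{F}_{q^5}\}$, and $L^\varepsilon_\gamma=L_{W^\varepsilon_\gamma}\subseteq\mathrm{PG}(1,q^5)$ for $\varepsilon\in\{0,1\}$. Then $L^\varepsilon_\gamma$ is of LP type whenever one of the following conditions holds: (a) $\varepsilon=0$ and $\operatorname{char}(\mathbb{F}_q)=7$; (b) $\varepsilon=1$ and $7\gamma^2+5\gamma+1=0$.
   Context: For an $\mathbb{F}_q$-subspace $U$ of $\mathbb{F}_{q^5}^2$, $L_U=\{\langle \mathbf{u}\rangle_{\mathbb{F}_{q^5}}:\mathbf{u}\in U\setminus\{\mathbf 0\}\}\subseteq\mathrm{PG}(1,q^5)$. $\mathrm{Tr}_{q^5/q}(x)=x+x^q+x^{q^2}+x^{q^3}+x^{q^4}$ and $\mathrm{N}_{q^5/q}(x)=x^{1+q+q^2+q^3+q^4}$. Two linear sets are projectively equivalent if an element of $\mathrm{PGL}(2,q^5)$ maps one onto the other as point sets. A linear set of $\mathrm{PG}(1,q^5)$ is of LP (Lunardon--Polverino) type if it is projectively equivalent to $\{\langle(x,x^{q^s}+\delta x^{q^{5-s}})\rangle_{\mathbb{F}_{q^5}}:x\in\mathbb{F}_{q^5}^*\}$ for some $1\le s<5$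 and some $\delta\in\mathbb{F}_{q^5}$ with $\mathrm{N}_{q^5/q}(\delta)\notin\{0,1\}$. -}

module Defs where

open import Level using (Level; _⊔_) renaming (suc to lsuc)
open import Algebra.Bundles using (CommutativeRing; Semiring)
import Algebra.Definitions.RawSemiring as RawSemiringDefs
open import Algebra.Morphism.Structures using (module RingMorphisms)
import Algebra.Properties.Ring as RingProperties
open import Data.Fin.Base using (Fin)
open import Data.Fin.Patterns using (0F; 1F)
open import Data.Nat.Base as ℕ using (ℕ; _≤_; _<_; _∸_)
import Data.Nat.Divisibility as ℕ
open import Data.Nat.Primality using (Prime)
open import Data.Product.Base using (Σ; ∃; ∃₂; _×_; _,_; proj₁; proj₂)
open import Function.Bundles using (Inverse)
open import Relation.Binary.PropositionalEquality as ≡ using (_≡_)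
import Relation.Binary.Reasoning.Setoid as SetoidReasoning
open import Relation.Nullary.Negation.Core using (¬_)
open import Relation.Unary using (Pred; _∈_; _≐_)

IsPrimePower : ℕ → Set
IsPrimePower q = ∃₂ λ p k → Prime p × 1 ≤ k × q ≡ p ℕ.^ k

record Field c ℓ : Set (lsuc (c ⊔ ℓ)) where
  field
    commutativeRing : CommutativeRing c ℓ
  open CommutativeRing commutativeRing public
  field
    1≉0     : ¬ 1# ≈ 0#
    inverse : ∀ x → ¬ x ≈ 0# → ∃ λ y → x * y ≈ 1#

  open RawSemiringDefs (Semiring.rawSemiring semiring) public using (_^_) renaming (_×_ to _·_)

  -- n generates the kernel of the canonical map from ℤ.
  HasCharacteristic : ℕ → Set ℓ
  HasCharacteristic n = n · 1# ≈ 0# × (∀ m → m · 1# ≈ 0# → n ℕ.∣ m)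

  cancel-nonzero : ∀ {d x} → ¬ d ≈ 0# → d * x ≈ 0# → x ≈ 0#
  cancel-nonzero {d} {x} d≉0 dx≈0 = begin
    x            ≈⟨ *-identityˡ x ⟨
    1# * x       ≈⟨ *-congʳ (proj₂ d⁻¹) ⟨
    (d * e) * x  ≈⟨ *-congʳ (*-comm d e) ⟩
    (e * d) * x  ≈⟨ *-assoc e d x ⟩
    e * (d * x)  ≈⟨ *-congˡ dx≈0 ⟩
    e * 0#       ≈⟨ zeroʳ e ⟩
    0#           ∎
    where
    open SetoidReasoning setoid
    d⁻¹ = inverse d d≉0
    e = proj₁ d⁻¹

record FiniteField c ℓ (n : ℕ) : Set (lsuc (c ⊔ ℓ)) where
  field
    asField : Field c ℓ
  open Field asField public
  field
    enumeration : Inverse setoid (≡.setoid (Fin n))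

record FiniteFieldExtension c ℓ (q n : ℕ) : Set (lsuc (c ⊔ ℓ)) where
  field
    base : FiniteField c ℓ q
    top  : FiniteField c ℓ (q ℕ.^ n)
  module F = FiniteField base
  module K = FiniteField top
  open RingMorphisms
    (CommutativeRing.rawRing F.commutativeRing)
    (CommutativeRing.rawRing K.commutativeRing)
    using (IsRingHomomorphism)
  field
    ι                  : F.Carrier → K.Carrier
    isRingHomomorphism : IsRingHomomorphism ι

module ProjectiveLine {c ℓ} (𝕂 : Field c ℓ) where
  open Field 𝕂

  Vector : Set c
  Vector = Carrier × Carrier

  infix 4 _≈ᵥ_ _∼_
  infixr 7 _*ᵥ_

  _≈ᵥ_ : Vector → Vector → Set ℓ
  (x , y) ≈ᵥ (x′ , y′) = x ≈ x′ × y ≈ y′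

  0ᵥ : Vector
  0ᵥ = 0# , 0#

  _*ᵥ_ : Carrier → Vector → Vector
  k *ᵥ (x , y) = k * x , k * y

  -- A point of PG(1,𝕂) is given by a nonzero vector spanning it; equality of
  -- points is _∼_.
  record Point : Set (c ⊔ ℓ) where
    constructor ⟨_,_⟩
    field
      vector  : Vector
      nonzero : ¬ vector ≈ᵥ 0ᵥ
  open Point public

  _∼_ : Point → Point → Set (c ⊔ ℓ)
  P ∼ Q = ∃ λ k → ¬ k ≈ 0# × vector P ≈ᵥ k *ᵥ vector Q

  PointSet : ∀ a → Set (c ⊔ ℓ ⊔ lsuc a)
  PointSet a = Pred Point a

  L : ∀ {a} → Pred Vector a → PointSet (c ⊔ ℓ ⊔ a)
  L U P = ∃ λ u → u ∈ U × Σ (¬ u ≈ᵥ 0ᵥ) λ u≉0 → P ∼ ⟨ u , u≉0 ⟩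

  record GL₂ : Set (c ⊔ ℓ) where
    field
      a₁₁ a₁₂ a₂₁ a₂₂ : Carrier
    det : Carrier
    det = a₁₁ * a₂₂ - a₁₂ * a₂₁
    field
      det≉0 : ¬ det ≈ 0#

    apply : Vector → Vector
    apply (x , y) = a₁₁ * x + a₁₂ * y , a₂₁ * x + a₂₂ * y

  private
    module Elimination where
      open SetoidReasoning setoid
      open RingProperties ring

      swap : ∀ a b x → a * (b * x) ≈ b * (a * x)
      swap a b x = begin
        a * (b * x)  ≈⟨ *-assoc a b x ⟨
        (a * b) * x  ≈⟨ *-congʳ (*-comm a b) ⟩
        (b * a) * x  ≈⟨ *-assoc b a x ⟩
        b * (a * x)  ∎

      cross : ∀ {a b c d x y} → a * x + b * y ≈ 0# → c * x + d * y ≈ 0# →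
              (a * d) * x ≈ (b * c) * x
      cross {a} {b} {c} {d} {x} {y} p r = begin
        (a * d) * x        ≈⟨ *-assoc a d x ⟩
        a * (d * x)        ≈⟨ swap a d x ⟩
        d * (a * x)        ≈⟨ *-congˡ (+-inverseˡ-unique _ _ p) ⟩
        d * - (b * y)      ≈⟨ -‿distribʳ-* d (b * y) ⟨
        - (d * (b * y))    ≈⟨ -‿cong (swap d b y) ⟩
        - (b * (d * y))    ≈⟨ -‿distribʳ-* b (d * y) ⟩
        b * - (d * y)      ≈⟨ *-congˡ (+-inverseˡ-unique _ _ r) ⟨
        b * (c * x)        ≈⟨ *-assoc b c x ⟨
        (b * c) * x        ∎

      det*≈0 : ∀ {s t x} → s * x ≈ t * x → (s - t) * x ≈ 0#
      det*≈0 {s} {t} {x} p = begin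
        (s - t) * x          ≈⟨ distribʳ x s (- t) ⟩
        s * x + (- t) * x    ≈⟨ +-cong p (sym (-‿distribˡ-* t x)) ⟩
        t * x - t * x        ≈⟨ -‿inverseʳ (t * x) ⟩
        0#                   ∎

      flip+ : ∀ {x y} → x + y ≈ 0# → y + x ≈ 0#
      flip+ p = trans (+-comm _ _) p

      x≈0 : ∀ {a b c d x y} → ¬ (a * d - b * c) ≈ 0# →
            a * x + b * y ≈ 0# → c * x + d * y ≈ 0# → x ≈ 0#
      x≈0 nz p r = cancel-nonzero nz (det*≈0 (cross p r))

      y≈0 : ∀ {a b c d x y} → ¬ (a * d - b * c) ≈ 0# →
            a * x + b * y ≈ 0# → c * x + d * y ≈ 0# → y ≈ 0#
      y≈0 {a} {b} {c} {d} nz p r = x≈0 (λ e → nz (trans comm e)) (flip+ r) (flip+ p)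
        where
        comm : a * d - b * c ≈ d * a - c * b
        comm = +-cong (*-comm a d) (-‿cong (*-comm b c))

  apply-nonzero : ∀ (A : GL₂) {v} → ¬ v ≈ᵥ 0ᵥ → ¬ GL₂.apply A v ≈ᵥ 0ᵥ
  apply-nonzero A v≉0 (p , r) =
    v≉0 (Elimination.x≈0 (GL₂.det≉0 A) p r , Elimination.y≈0 (GL₂.det≉0 A) p r)

  -- The projectivity in PGL(2,𝕂) represented by an invertible matrix.
  projectivity : GL₂ → Point → Point
  projectivity A P = ⟨ GL₂.apply A (vector P) , apply-nonzero A (nonzero P) ⟩

  image : ∀ {a} → GL₂ → PointSet a → PointSet (c ⊔ ℓ ⊔ a)
  image A S Q = ∃ λ P → P ∈ S × Q ∼ projectivity A P

  -- Meaningful for point sets closed under _∼_, such as L U.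
  ProjectivelyEquivalent : ∀ {a b} → PointSet a → PointSet b → Set (c ⊔ ℓ ⊔ a ⊔ b)
  ProjectivelyEquivalent S T = ∃ λ A → image A S ≐ T

module LinearSets {c ℓ q} (E : FiniteFieldExtension c ℓ q 5) where
  open FiniteFieldExtension E
  open K
  open ProjectiveLine asField public

  Tr : Carrier → Carrier
  Tr x = x + x ^ q + x ^ (q ℕ.^ 2) + x ^ (q ℕ.^ 3) + x ^ (q ℕ.^ 4)

  N : Carrier → Carrier
  N x = x ^ (1 ℕ.+ q ℕ.+ q ℕ.^ 2 ℕ.+ q ℕ.^ 3 ℕ.+ q ℕ.^ 4)

  LPSet : ℕ → Carrier → PointSet (c ⊔ ℓ)
  LPSet s δ P = ∃ λ x → Σ (¬ x ≈ 0#) λ x≉0 →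
    P ∼ ⟨ (x , x ^ (q ℕ.^ s) + δ * x ^ (q ℕ.^ (5 ∸ s))) , (λ v≈0 → x≉0 (proj₁ v≈0)) ⟩

  IsLPType : ∀ {a} → PointSet a → Set (c ⊔ ℓ ⊔ a)
  IsLPType S = ∃₂ λ s δ →
    1 ≤ s × s < 5 × ¬ N δ ≈ 0# × ¬ N δ ≈ 1# × ProjectivelyEquivalent S (LPSet s δ)

  W : Fin 2 → F.Carrier → Pred Vector (c ⊔ ℓ)
  W 0F γ v = ∃₂ λ x h → Tr x ≈ 0# × v ≈ᵥ (x , x ^ q + ι γ * ι h)
  W 1F γ v = ∃ λ x → v ≈ᵥ (x , x ^ q + ι γ * Tr x)

{-# OPTIONS --safe #-}

-- Let δ ∈ F_q satisfy δ² − δ + 1 = 0 and write xᵢ = x^(qⁱ).  The unimodular matrix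
-- A = (δ 1 ; −δ −δ) maps the F_q-space of all (x, x₁ + η) with η ∈ F_q and
-- δ Tr(x) + (1 + 2δ) η = 0 onto { (y, y₂ + δ y₃) : y ∈ F_{q⁵} }; the preimage of y is given
-- by x = −(δ y + y₂ + δ y₃) and η = δ Tr(y).  Since N(δ) = δ⁵ = 1 − δ is neither 0 nor 1,
-- the associated linear set is of LP type with s = 2.  In characteristic 7 the choice δ = 3
-- makes 1 + 2δ vanish and the space becomes W⁰_γ (for every γ); if 7γ² + 5γ + 1 = 0, then
-- δ = −(7γ + 2) satisfies γ(1 + 2δ) = −δ and the space becomes W¹_γ.
module Submission where

open import Defs
open import Algebra.Bundles using (CommutativeMonoid; CommutativeRing; CommutativeSemiring)
open import Algebra.Morphism.Structures using (module RingMorphisms)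
import Algebra.Properties.CommutativeMonoid.Sum as Sum
import Algebra.Properties.CommutativeSemiring.Binomial as Binomial
import Algebra.Properties.CommutativeSemiring.Exp as Exp
import Algebra.Properties.Ring as RingProperties
import Algebra.Properties.Semiring.Mult as Mult
import Algebra.Solver.Ring.NaturalCoefficients.Default as Solver
open import Data.Fin.Base using (Fin; zero; suc; fromℕ; inject₁)
open import Data.Fin.Patterns using (0F; 1F)
open import Data.Fin.Permutation using (Permutation′; permutation)
import Data.Fin.Properties as Fin
open import Data.Nat.Base as ℕ using (ℕ; zero; suc; _≤_; _<_; _∸_; _!; z≤n; s≤s)
open import Data.Nat.Combinatorics using (_C_; nCn≡1; nCk≡n!/k![n-k]!; nCk≡nC[n∸k]; k![n∸k]!∣n!)
open import Data.Nat.Divisibility using (_∣_; divides; m∣m*n; ∣⇒≤)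
open import Data.Nat.DivMod using (m*[n/m]≡n)
open import Data.Nat.Primality using (Prime; euclidsLemma; ¬prime[0]; ¬prime[1])
import Data.Nat.Properties as ℕ
open import Data.Product.Base using (_×_; _,_; proj₁; proj₂; ∃; ∃₂)
open import Data.Sum.Base using (_⊎_; inj₁; inj₂)
open import Data.Vec.Base using (Vec; []; _∷_; replicate)
open import Function.Base using (_∘_)
open import Function.Bundles using (Inverse)
open import Function.Definitions using (Injective)
open import Function.Properties.Inverse using (Inverse⇒Injection)
open import Level using (_⊔_)
open import Relation.Binary.Definitions using (Decidable)
open import Relation.Binary.PropositionalEquality as ≡ using (_≡_; _≢_)
import Relation.Binary.Reasoning.Setoid as SetoidReasoning
open import Relation.Nullary.Decidable using (yes; no; via-injection; decidable-stable)
open import Relation.Nullary.Negation.Core using (¬_; contradiction)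
open import Relation.Unary using (Pred; _≐_; _⊆_)

-- Primes dividing factorials and binomial coefficients.

prime∣m!⇒≤ : ∀ {p} → Prime p → ∀ m → p ∣ m ! → p ≤ m
prime∣m!⇒≤ pp zero    p∣1  with ∣⇒≤ p∣1
... | s≤s z≤n = contradiction pp ¬prime[1]
prime∣m!⇒≤ pp (suc m) p∣m! with euclidsLemma (suc m) (m !) pp p∣m!
... | inj₁ p∣1+m = ∣⇒≤ p∣1+m
... | inj₂ p∣m!′ = ℕ.m≤n⇒m≤1+n (prime∣m!⇒≤ pp m p∣m!′)

-- The prime p divides p! = k! (p - k)! (p C k), but neither of the two factorials, since both k and
-- p - k lie below p.
prime∣binomial : ∀ {p k} → Prime p → 0 < k → k < p → p ∣ p C k
prime∣binomial {zero}      pp _   _   = contradiction pp ¬prime[0]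
prime∣binomial {p@(suc r)} {k@(suc j)} pp 0<k k<p
  with euclidsLemma (k ! ℕ.* (p ∸ k) !) (p C k) pp (≡.subst (p ∣_) (≡.sym factorial) (m∣m*n (r !)))
  where
  instance _ = ℕ._!*_!≢0 k (p ∸ k)
  factorial : k ! ℕ.* (p ∸ k) ! ℕ.* (p C k) ≡ p !
  factorial = ≡.trans
    (≡.cong (k ! ℕ.* (p ∸ k) ! ℕ.*_) (nCk≡n!/k![n-k]! (ℕ.<⇒≤ k<p)))
    (m*[n/m]≡n (k![n∸k]!∣n! (ℕ.<⇒≤ k<p)))
... | inj₂ p∣C = p∣C
... | inj₁ p∣k![p∸k]! with euclidsLemma (k !) ((p ∸ k) !) pp p∣k![p∸k]!
...   | inj₁ p∣k!      = contradiction (prime∣m!⇒≤ pp k p∣k!) (ℕ.<⇒≱ k<p)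
...   | inj₂ p∣[p∸k]!  = contradiction (prime∣m!⇒≤ pp (p ∸ k) p∣[p∸k]!) (ℕ.<⇒≱ (s≤s (ℕ.m∸n≤m r j)))

-- Finite sums with at most one nontrivial term.

module _ {c ℓ} (M : CommutativeMonoid c ℓ) where
  open CommutativeMonoid M
  open Sum M

  sum-zero : ∀ {n} (t : Fin n → Carrier) → (∀ i → t i ≈ ε) → sum t ≈ ε
  sum-zero {n} t t≈0 = trans (sum-cong-≋ t≈0) (sum-replicate-zero n)

  sum-single : ∀ {n} (i : Fin n) (t : Fin n → Carrier) →
               (∀ j → j ≢ i → t j ≈ ε) → sum t ≈ t i
  sum-single zero    t t≈0 =
    trans (∙-congˡ (sum-zero (t ∘ suc) (λ j → t≈0 (suc j) λ ()))) (identityʳ _)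
  sum-single (suc i) t t≈0 = trans (∙-cong (t≈0 zero λ ())
    (sum-single i (t ∘ suc) (λ j j≢i → t≈0 (suc j) (j≢i ∘ Fin.suc-injective)))) (identityˡ _)

-- Additivity of the Frobenius map in prime characteristic.

module Frobenius {c ℓ} (S : CommutativeSemiring c ℓ) where
  open CommutativeSemiring S
  open Mult semiring renaming (_×_ to _·_)
  open Exp S
  open Sum +-commutativeMonoid using (sum-init-last)
  open SetoidReasoning setoid

  ·-zero : ∀ {p m} → p · 1# ≈ 0# → p ∣ m → ∀ x → m · x ≈ 0#
  ·-zero {p} p·1≈0 (divides k ≡.refl) x = begin
    (k ℕ.* p) · x         ≈⟨ ×-assocˡ x k p ⟨
    k · (p · x)           ≈⟨ ×-congʳ k (×-congʳ p (*-identityˡ x)) ⟨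
    k · (p · (1# * x))    ≈⟨ ×-congʳ k (×-assoc-* p 1# x) ⟨
    k · (p · 1# * x)      ≈⟨ ×-congʳ k (*-congʳ p·1≈0) ⟩
    k · (0# * x)          ≈⟨ ×-assoc-* k 0# x ⟨
    k · 0# * x            ≈⟨ *-congʳ (×-zeroʳ k) ⟩
    0# * x                ≈⟨ zeroˡ x ⟩
    0#                    ∎
    where
    ×-zeroʳ : ∀ k → k · 0# ≈ 0#
    ×-zeroʳ zero    = refl
    ×-zeroʳ (suc k) = trans (+-identityˡ _) (×-zeroʳ k)

  module _ {p} (pp : Prime p) (p·1≈0 : p · 1# ≈ 0#) where

    ^p-distrib-+ : ∀ x y → (x + y) ^ p ≈ x ^ p + y ^ p
    ^p-distrib-+ x y = go p ≡.refl
      where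
      open Binomial S using (theorem; binomialTerm)
      -- The exponent is generalised so that it can be split as `suc m`; the binomial sum then peels
      -- off its first and last terms.
      go : ∀ n → n ≡ p → (x + y) ^ n ≈ x ^ n + y ^ n
      go zero    ≡.refl = contradiction pp ¬prime[0]
      go (suc m) ≡.refl = begin
        (x + y) ^ suc m                ≈⟨ theorem (suc m) x y ⟩
        t 0F + Sum.sum +-commutativeMonoid (t ∘ suc)
                                       ≈⟨ +-congˡ (sum-init-last (t ∘ suc)) ⟩
        t 0F + (Sum.sum +-commutativeMonoid (λ i → t (suc (inject₁ i))) + t (suc (fromℕ m)))
                                       ≈⟨ +-cong first (+-cong (sum-zero +-commutativeMonoid _ inner) last) ⟩
        y ^ suc m + (0# + x ^ suc m)   ≈⟨ +-congˡ (+-identityˡ _) ⟩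
        y ^ suc m + x ^ suc m          ≈⟨ +-comm _ _ ⟩
        x ^ suc m + y ^ suc m          ∎
        where
        t = binomialTerm x y (suc m)
        first : t 0F ≈ y ^ suc m
        first = begin
          (suc m C 0) · (1# * y ^ suc m)
            ≈⟨ ×-cong (≡.trans (nCk≡nC[n∸k] {k = 0} {n = suc m} z≤n) (nCn≡1 (suc m))) (*-identityˡ _) ⟩
          1 · (y ^ suc m)                 ≈⟨ ×-homo-1 _ ⟩
          y ^ suc m                       ∎
        last : t (suc (fromℕ m)) ≈ x ^ suc m
        last rewrite Fin.toℕ-fromℕ m | nCn≡1 (suc m) | ℕ.n∸n≡0 m =
          trans (×-homo-1 _) (*-identityʳ _)
        -- The binomial index is i + 1 with i < m, hence strictly between 0 and p = `suc m`.
        inner : ∀ i → t (suc (inject₁ i)) ≈ 0#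
        inner i = ·-zero p·1≈0
          (prime∣binomial pp (s≤s z≤n) (s≤s (≡.subst (_< m) (≡.sym (Fin.toℕ-inject₁ i)) (Fin.toℕ<n i)))) _

    ^p^k-distrib-+ : ∀ k x y → (x + y) ^ (p ℕ.^ k) ≈ x ^ (p ℕ.^ k) + y ^ (p ℕ.^ k)
    ^p^k-distrib-+ zero    x y = trans (*-identityʳ _) (sym (+-cong (*-identityʳ x) (*-identityʳ y)))
    ^p^k-distrib-+ (suc k) x y = begin
      (x + y) ^ (p ℕ.* r)              ≈⟨ ^-assocʳ (x + y) p r ⟨
      ((x + y) ^ p) ^ r                ≈⟨ ^-congˡ r (^p-distrib-+ x y) ⟩
      (x ^ p + y ^ p) ^ r              ≈⟨ ^p^k-distrib-+ k (x ^ p) (y ^ p) ⟩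
      (x ^ p) ^ r + (y ^ p) ^ r        ≈⟨ +-cong (^-assocʳ x p r) (^-assocʳ y p r) ⟩
      x ^ (p ℕ.* r) + y ^ (p ℕ.* r)    ∎
      where r = p ℕ.^ k

-- Fields and the number of roots of a monic polynomial.

module FieldProperties {c ℓ} (𝔽 : Field c ℓ) where
  open Field 𝔽
  open Mult semiring using (×1-homo-*)
  open RingProperties ring using (x∙y⁻¹≈ε⇒x≈y; x[y-z]≈xy-xz; [y-z]x≈yx-zx)
  open SetoidReasoning setoid

  *-nonzero : ∀ {x y} → ¬ x ≈ 0# → ¬ y ≈ 0# → ¬ x * y ≈ 0#
  *-nonzero x≉0 y≉0 xy≈0 = y≉0 (cancel-nonzero x≉0 xy≈0)

  *-cancelˡ-nonzero : ∀ {d x y} → ¬ d ≈ 0# → d * x ≈ d * y → x ≈ y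
  *-cancelˡ-nonzero {d} {x} {y} d≉0 dx≈dy = x∙y⁻¹≈ε⇒x≈y x y (cancel-nonzero d≉0 (begin
    d * (x - y)      ≈⟨ x[y-z]≈xy-xz d x y ⟩
    d * x - d * y    ≈⟨ +-congʳ dx≈dy ⟩
    d * y - d * y    ≈⟨ -‿inverseʳ _ ⟩
    0#               ∎))

  ^-nonzero : ∀ {x} → ¬ x ≈ 0# → ∀ n → ¬ x ^ n ≈ 0#
  ^-nonzero x≉0 zero    = 1≉0
  ^-nonzero x≉0 (suc n) = *-nonzero x≉0 (^-nonzero x≉0 n)

  p^k·1≈[p·1]^k : ∀ p k → (p ℕ.^ k) · 1# ≈ (p · 1#) ^ k
  p^k·1≈[p·1]^k p zero    = +-identityʳ 1#
  p^k·1≈[p·1]^k p (suc k) = trans (×1-homo-* p (p ℕ.^ k)) (*-congˡ (p^k·1≈[p·1]^k p k))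

  -- The value at x of the monic polynomial xⁿ + cₙ₋₁xⁿ⁻¹ + … + c₀, where cs = c₀ ∷ … ∷ cₙ₋₁ ∷ [].
  monic : ∀ {n} → Vec Carrier n → Carrier → Carrier
  monic []       x = 1#
  monic (c ∷ cs) x = c + x * monic cs x

  -- Synthetic division by X - a: the coefficients are the Horner values at a of the successive
  -- tails, and the remainder is dropped.
  quotient : ∀ {n} → Carrier → Vec Carrier (suc n) → Vec Carrier n
  quotient {zero}  a _        = []
  quotient {suc n} a (c ∷ cs) = monic cs a ∷ quotient a cs

  -- This is p(x) - p(a) = (x - a) r(x), with r the quotient, rearranged so that no subtraction
  -- occurs.
  factor-theorem : ∀ {n} a (cs : Vec Carrier (suc n)) x →
    monic cs x + a * monic (quotient a cs) x ≈ monic cs a + x * monic (quotient a cs) x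
  factor-theorem a (c ∷ []) x =
    solve 3 (λ a c x → (c :+ x :* con 1) :+ a :* con 1 := (c :+ a :* con 1) :+ x :* con 1) refl a c x
    where open Solver commutativeSemiring
  factor-theorem {suc n} a (c ∷ cs) x = begin
    (c + x * p x) + a * (p a + x * r)    ≈⟨ solve 6 (λ a c x u v r →
      (c :+ x :* u) :+ a :* (v :+ x :* r) := (c :+ a :* v) :+ x :* (u :+ a :* r)) refl a c x (p x) (p a) r ⟩
    (c + a * p a) + x * (p x + a * r)    ≈⟨ +-congˡ (*-congˡ (factor-theorem a cs x)) ⟩
    (c + a * p a) + x * (p a + x * r)    ∎
    where
    open Solver commutativeSemiring
    p = monic cs
    r = monic (quotient a cs) x

  -- Induction on the degree: after dividing by X - `f 0F`, the remaining n points are still roots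
  -- of the quotient, because x - `f 0F` is nonzero there.
  monic-roots : ∀ {n} (cs : Vec Carrier n) (f : Fin (suc n) → Carrier) →
    Injective _≡_ _≈_ f → ¬ (∀ i → monic cs (f i) ≈ 0#)
  monic-roots []       f inj root = 1≉0 (root 0F)
  monic-roots cs@(_ ∷ _) f inj root =
    monic-roots (quotient a cs) (f ∘ suc) (Fin.suc-injective ∘ inj) λ i →
      root′ (f (suc i)) (root (suc i)) λ e → contradiction (inj e) λ ()
    where
    a = f 0F
    root′ : ∀ x → monic cs x ≈ 0# → ¬ x ≈ a → monic (quotient a cs) x ≈ 0#
    root′ x px≈0 x≉a = cancel-nonzero (x≉a ∘ x∙y⁻¹≈ε⇒x≈y x a) (begin
      (x - a) * r               ≈⟨ [y-z]x≈yx-zx r x a ⟩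
      x * r - a * r             ≈⟨ +-congʳ (+-identityˡ _) ⟨
      (0# + x * r) - a * r      ≈⟨ +-congʳ (+-congʳ (root 0F)) ⟨
      (monic cs a + x * r) - a * r  ≈⟨ +-congʳ (factor-theorem a cs x) ⟨
      (monic cs x + a * r) - a * r  ≈⟨ +-congʳ (+-congʳ px≈0) ⟩
      (0# + a * r) - a * r      ≈⟨ +-congʳ (+-identityˡ _) ⟩
      a * r - a * r             ≈⟨ -‿inverseʳ _ ⟩
      0#                        ∎)
      where r = monic (quotient a cs) x

  monic-^ : ∀ m x → monic (replicate m 0#) x ≈ x ^ m
  monic-^ zero    x = refl
  monic-^ (suc m) x = trans (+-identityˡ _) (*-congˡ (monic-^ m x))

  Xⁿ-X-roots : ∀ {n} → 2 ≤ n → (f : Fin (suc n) → Carrier) →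
    Injective _≡_ _≈_ f → ¬ (∀ i → f i ^ n ≈ f i)
  Xⁿ-X-roots {suc (suc m)} (s≤s (s≤s _)) f inj f^n≈f =
    -- Since n is at least 2, the linear coefficient -1 is distinct from the implicit leading 1.
    monic-roots (0# ∷ - 1# ∷ replicate m 0#) f inj (λ i → root (f i) (f^n≈f i))
    where
    root : ∀ x → x ^ suc (suc m) ≈ x → monic (0# ∷ - 1# ∷ replicate m 0#) x ≈ 0#
    root x x^n≈x = begin
      0# + x * (- 1# + x * monic (replicate m 0#) x)
        ≈⟨ +-identityˡ _ ⟩
      x * (- 1# + x * monic (replicate m 0#) x)
        ≈⟨ *-congˡ (+-congˡ (*-congˡ (monic-^ m x))) ⟩
      x * (- 1# + x ^ suc m)       ≈⟨ distribˡ x _ _ ⟩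
      x * - 1# + x ^ suc (suc m)   ≈⟨ +-congˡ (trans x^n≈x (sym (*-identityʳ x))) ⟩
      x * - 1# + x * 1#            ≈⟨ distribˡ x _ _ ⟨
      x * (- 1# + 1#)              ≈⟨ *-congˡ (-‿inverseˡ 1#) ⟩
      x * 0#                       ≈⟨ zeroʳ x ⟩
      0#                           ∎

-- Finite fields: permutation arguments and Fermat's theorem.

module FiniteFieldProperties {c ℓ n} (𝔽 : FiniteField c ℓ n) where
  open FiniteField 𝔽
  open FieldProperties asField
  open Inverse enumeration using (to; from; to-cong; inverseˡ; inverseʳ)
  open RingProperties ring using (+-identityʳ-unique; //-rightDividesˡ; //-rightDividesʳ)
  open Exp commutativeSemiring using (^-congˡ)
  open SetoidReasoning setoid

  infix 4 _≟_
  _≟_ : Decidable _≈_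
  _≟_ = via-injection (Inverse⇒Injection enumeration) Fin._≟_

  from-to : ∀ x → from (to x) ≈ x
  from-to x = inverseʳ ≡.refl

  to-injective : ∀ {x y} → to x ≡ to y → x ≈ y
  to-injective {x} {y} e = trans (sym (from-to x)) (inverseʳ e)

  from-injective : ∀ {i j} → from i ≈ from j → i ≡ j
  from-injective e = ≡.trans (≡.sym (inverseˡ refl)) (inverseˡ e)

  2≤cardinality : 2 ≤ n
  2≤cardinality = distinct⇒2≤ (to 1#) (to 0#) (1≉0 ∘ to-injective)
    where
    distinct⇒2≤ : ∀ {m} (i j : Fin m) → i ≢ j → 2 ≤ m
    distinct⇒2≤ {suc zero}    0F 0F i≢j = contradiction ≡.refl i≢j
    distinct⇒2≤ {suc (suc m)} _  _  _   = s≤s (s≤s z≤n)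

  module Reindex {a b} (M : CommutativeMonoid a b) where
    open CommutativeMonoid M using () renaming (Carrier to A; _≈_ to _≈ₘ_; trans to transₘ)
    open Sum M public

    -- The bijection `f` with inverse `g` becomes a permutation of `Fin n` through the enumeration,
    -- and a commutative sum is invariant under permutation. The summand `φ` is arbitrary so that
    -- products can be padded at 0.
    sum-reindex : (φ : Carrier → A) → (∀ {x y} → x ≈ y → φ x ≈ₘ φ y) →
      (f g : Carrier → Carrier) → (∀ {x y} → x ≈ y → f x ≈ f y) → (∀ {x y} → x ≈ y → g x ≈ g y) →
      (∀ x → f (g x) ≈ x) → (∀ x → g (f x) ≈ x) →
      sum (φ ∘ from) ≈ₘ sum (φ ∘ f ∘ from)
    sum-reindex φ φ-cong f g f-cong g-cong fg gf =
      transₘ (sum-permute (φ ∘ from) π) (sum-cong-≋ (λ i → φ-cong (from-to (f (from i)))))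
      where
      conj-inverse : ∀ {f g : Carrier → Carrier} → (∀ {x y} → x ≈ y → f x ≈ f y) →
        (∀ x → f (g x) ≈ x) → ∀ i → to (f (from (to (g (from i))))) ≡ i
      conj-inverse f-cong fg i =
        ≡.trans (to-cong (trans (f-cong (from-to _)) (fg (from i)))) (inverseˡ refl)
      π : Permutation′ n
      π = permutation (to ∘ f ∘ from) (to ∘ g ∘ from) (conj-inverse f-cong fg) (conj-inverse g-cong gf)

  -- Translation by 1 permutes the field, so the sum S of all elements satisfies S + n · 1 = S.
  cardinality·1≈0 : n · 1# ≈ 0#
  cardinality·1≈0 = +-identityʳ-unique (sum from) (n · 1#) (begin
    sum from + n · 1#                 ≈⟨ +-congˡ (sum-replicate n) ⟨
    sum from + sum {n} (λ _ → 1#)     ≈⟨ ∑-distrib-+ from (λ _ → 1#) ⟨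
    sum (λ i → from i + 1#)           ≈⟨ sum-reindex (λ x → x) (λ e → e) (_+ 1#) (_- 1#) +-congʳ +-congʳ
                                           (//-rightDividesˡ 1#) (//-rightDividesʳ 1#) ⟨
    sum from                          ∎)
    where open Reindex +-commutativeMonoid

  -- Multiplication by a ≉ 0 permutes the field; comparing the products of all
  -- nonzero elements, and padding at 0, gives a · ∏ φ ≈ aⁿ · ∏ φ.
  ^cardinality : ∀ a → a ^ n ≈ a
  ^cardinality a with a ≟ 0#
  ... | yes a≈0 = trans (^-congˡ n a≈0) (trans (0^ n (to 0#)) (sym a≈0))
    where
    -- The argument in `Fin n` rules out n = 0, where the power would be 1.
    0^ : ∀ n → Fin n → 0# ^ n ≈ 0#
    0^ (suc n) _ = zeroˡ _
  ... | no a≉0 = *-cancelˡ-nonzero (∏-nonzero (φ ∘ from) (φ-nonzero ∘ from)) (begin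
    ∏ * a ^ n                                     ≈⟨ *-comm _ _ ⟩
    a ^ n * ∏                                     ≈⟨ *-congʳ (sum-replicate n) ⟨
    sum {n} (λ _ → a) * ∏                         ≈⟨ ∑-distrib-+ (λ _ → a) (φ ∘ from) ⟨
    sum (λ i → a * φ (from i))                    ≈⟨ sum-cong-≋ (λ i → pad (from i)) ⟩
    sum (λ i → φ (a * from i) * ψ (from i))       ≈⟨ ∑-distrib-+ (λ i → φ (a * from i)) (ψ ∘ from) ⟩
    sum (λ i → φ (a * from i)) * sum (ψ ∘ from)   ≈⟨ *-cong (sym permuted) ∏ψ≈a ⟩
    ∏ * a                                         ∎)
    where
    -- In this monoid `sum` is a product and `sum-replicate` produces a power.
    open Reindex *-commutativeMonoid

    a⁻¹ : Carrier
    a⁻¹ = proj₁ (inverse a a≉0)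

    φ ψ : Carrier → Carrier
    φ x with x ≟ 0#
    ... | yes _ = 1#
    ... | no  _ = x
    ψ x with x ≟ 0#
    ... | yes _ = a
    ... | no  _ = 1#

    ∏ : Carrier
    ∏ = sum (φ ∘ from)

    φ-cong : ∀ {x y} → x ≈ y → φ x ≈ φ y
    φ-cong {x} {y} x≈y with x ≟ 0# | y ≟ 0#
    ... | yes _   | yes _   = refl
    ... | no  _   | no  _   = x≈y
    ... | yes x≈0 | no y≉0  = contradiction (trans (sym x≈y) x≈0) y≉0
    ... | no x≉0  | yes y≈0 = contradiction (trans x≈y y≈0) x≉0

    φ-nonzero : ∀ x → ¬ φ x ≈ 0#
    φ-nonzero x with x ≟ 0#
    ... | yes _  = 1≉0
    ... | no x≉0 = x≉0

    ∏-nonzero : ∀ {m} (t : Fin m → Carrier) → (∀ i → ¬ t i ≈ 0#) → ¬ sum t ≈ 0#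
    ∏-nonzero {zero}  t t≉0 = 1≉0
    ∏-nonzero {suc m} t t≉0 = *-nonzero (t≉0 0F) (∏-nonzero (t ∘ suc) (t≉0 ∘ suc))

    -- At x = 0 the factor a on the left is supplied by `ψ`, which is 1 elsewhere; its product over
    -- the field is therefore a single a.
    pad : ∀ x → a * φ x ≈ φ (a * x) * ψ x
    pad x with x ≟ 0# | a * x ≟ 0#
    ... | yes _   | yes _    = *-comm a 1#
    ... | no _    | no _     = sym (*-identityʳ _)
    ... | yes x≈0 | no ax≉0  = contradiction (trans (*-congˡ x≈0) (zeroʳ a)) ax≉0
    ... | no x≉0  | yes ax≈0 = contradiction ax≈0 (*-nonzero a≉0 x≉0)

    permuted : ∏ ≈ sum (λ i → φ (a * from i))
    permuted = sum-reindex φ φ-cong (a *_) (a⁻¹ *_) *-congˡ *-congˡ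
      (cancel a a⁻¹ (proj₂ (inverse a a≉0)))
      (cancel a⁻¹ a (trans (*-comm a⁻¹ a) (proj₂ (inverse a a≉0))))
      where
      cancel : ∀ u v → u * v ≈ 1# → ∀ x → u * (v * x) ≈ x
      cancel u v uv≈1 x = trans (sym (*-assoc u v x)) (trans (*-congʳ uv≈1) (*-identityˡ x))

    ∏ψ≈a : sum (ψ ∘ from) ≈ a
    ∏ψ≈a = trans (sum-single *-commutativeMonoid (to 0#) (ψ ∘ from) off) on
      where
      off : ∀ j → j ≢ to 0# → ψ (from j) ≈ 1#
      off j j≢ with from j ≟ 0#
      ... | yes fj≈0 = contradiction (≡.trans (≡.sym (inverseˡ refl)) (to-cong fj≈0)) j≢
      ... | no  _    = refl
      on : ψ (from (to 0#)) ≈ a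
      on with from (to 0#) ≟ 0#
      ... | yes _  = refl
      ... | no ≉0  = contradiction (from-to 0#) ≉0

-- The embedding of the base field and its image as the fixed field of Frobenius.

module ExtensionProperties {c ℓ q n} (E : FiniteFieldExtension c ℓ q n) where
  open FiniteFieldExtension E
  open K
  private
    module F′ = FiniteFieldProperties base
    module K′ = FiniteFieldProperties top
  open FieldProperties asField
  open Inverse F.enumeration using (from)
  open RingMorphisms
    (CommutativeRing.rawRing F.commutativeRing)
    (CommutativeRing.rawRing K.commutativeRing)
    using (module IsRingHomomorphism)
  open IsRingHomomorphism isRingHomomorphism public
    using (+-homo; *-homo; 0#-homo; 1#-homo; -‿homo)
    renaming (⟦⟧-cong to ι-cong)
  open SetoidReasoning setoid

  ι-^ : ∀ a m → ι (a F.^ m) ≈ ι a ^ m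
  ι-^ a zero    = 1#-homo
  ι-^ a (suc m) = trans (*-homo a (a F.^ m)) (*-congˡ (ι-^ a m))

  ι-· : ∀ m a → ι (m F.· a) ≈ m · ι a
  ι-· zero    a = 0#-homo
  ι-· (suc m) a = trans (+-homo a (m F.· a)) (+-congˡ (ι-· m a))

  ι-nonzero : ∀ {a} → ¬ a F.≈ F.0# → ¬ ι a ≈ 0#
  ι-nonzero {a} a≉0 ιa≈0 = 1≉0 (begin
    1#              ≈⟨ 1#-homo ⟨
    ι F.1#          ≈⟨ ι-cong (proj₂ (F.inverse a a≉0)) ⟨
    ι (a F.* b)     ≈⟨ *-homo a b ⟩
    ι a * ι b       ≈⟨ *-congʳ ιa≈0 ⟩
    0# * ι b        ≈⟨ zeroˡ _ ⟩
    0#              ∎)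
    where b = proj₁ (F.inverse a a≉0)

  -- A nonzero difference has a nonzero image; decidable equality in F turns the resulting
  -- contradiction into an equality.
  ι-injective : ∀ {a b} → ι a ≈ ι b → a F.≈ b
  ι-injective {a} {b} ιa≈ιb = decidable-stable (a F′.≟ b) λ a≉b →
    ι-nonzero (a≉b ∘ x∙y⁻¹≈ε⇒x≈y a b) (begin
      ι (a F.- b)      ≈⟨ trans (+-homo a (F.- b)) (+-congˡ (-‿homo b)) ⟩
      ι a - ι b        ≈⟨ +-congʳ ιa≈ιb ⟩
      ι b - ι b        ≈⟨ -‿inverseʳ _ ⟩
      0#               ∎)
    where open RingProperties F.ring using (x∙y⁻¹≈ε⇒x≈y)

  ι^q≈ι : ∀ a → ι a ^ q ≈ ι a
  ι^q≈ι a = trans (sym (ι-^ a q)) (ι-cong (F′.^cardinality a))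

  -- With q = p^k, the power (p · 1)^k equals q · 1 = 0 in F, so p · 1 = 0 there. The embedding
  -- carries this to K, where the k-fold Frobenius is then additive.
  ^q-distrib-+ : IsPrimePower q → ∀ x y → (x + y) ^ q ≈ x ^ q + y ^ q
  ^q-distrib-+ (p , k , pp , _ , ≡.refl) =
    Frobenius.^p^k-distrib-+ commutativeSemiring pp p·1≈0 k
    where
    p·1≈0 : p · 1# ≈ 0#
    p·1≈0 = begin
      p · 1#           ≈⟨ Mult.×-congʳ semiring p 1#-homo ⟨
      p · ι F.1#       ≈⟨ ι-· p F.1# ⟨
      ι (p F.· F.1#)   ≈⟨ ι-cong (decidable-stable (p F.· F.1# F′.≟ F.0#) λ p·1≉0 →
        FieldProperties.^-nonzero F.asField p·1≉0 k (F.trans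
          (F.sym (FieldProperties.p^k·1≈[p·1]^k F.asField p k)) F′.cardinality·1≈0)) ⟩
      ι F.0#           ≈⟨ 0#-homo ⟩
      0#               ∎

  -- Otherwise z and the q elements of F would be q + 1 roots of X^q − X.
  fixed⇒∈ι : ∀ z → z ^ q ≈ z → ∃ λ a → ι a ≈ z
  fixed⇒∈ι z z^q≈z with Fin.any? (λ i → ι (from i) K′.≟ z)
  ... | yes (i , ιi≈z) = from i , ιi≈z
  ... | no z∉ι = contradiction roots (Xⁿ-X-roots F′.2≤cardinality points points-injective)
    where
    points : Fin (suc q) → Carrier
    points zero    = z
    points (suc i) = ι (from i)

    points-injective : Injective _≡_ _≈_ points
    points-injective {zero}  {zero}  _ = ≡.refl
    points-injective {zero}  {suc j} e = contradiction (j , sym e) z∉ι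
    points-injective {suc i} {zero}  e = contradiction (i , e) z∉ι
    points-injective {suc i} {suc j} e = ≡.cong suc (F′.from-injective (ι-injective e))

    roots : ∀ i → points i ^ q ≈ points i
    roots zero    = z^q≈z
    roots (suc i) = ι^q≈ι (from i)

-- Frobenius conjugates, the trace, and the model space.

module LPType {c ℓ q} (q-primePower : IsPrimePower q) (E : FiniteFieldExtension c ℓ q 5) where
  open FiniteFieldExtension E
  open K
  open LinearSets E
  open ExtensionProperties E
  open FiniteFieldProperties top using (^cardinality)
  open FieldProperties asField using (*-nonzero)
  open Exp commutativeSemiring using (^-congˡ; ^-congʳ; ^-homo-*; ^-assocʳ; ^-distrib-*)
  open RingProperties ring using (+-cancelʳ; +-inverseˡ-unique; -‿+-comm; -‿distribˡ-*)
  open Solver commutativeSemiring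
  open SetoidReasoning setoid

  infixl 9 _⁽_⁾
  _⁽_⁾ : Carrier → ℕ → Carrier
  x ⁽ i ⁾ = x ^ (q ℕ.^ i)

  ⁽⁾-cong : ∀ i {x y} → x ≈ y → x ⁽ i ⁾ ≈ y ⁽ i ⁾
  ⁽⁾-cong i = ^-congˡ (q ℕ.^ i)

  -- `Tr` and `W` are written with `x ^ q`, whereas `x ⁽ 1 ⁾` has exponent q * 1.
  ⁽1⁾≈^q : ∀ x → x ⁽ 1 ⁾ ≈ x ^ q
  ⁽1⁾≈^q x = ^-congʳ x (ℕ.*-identityʳ q)

  ⁽⁾-⁽⁾ : ∀ x i j → x ⁽ i ⁾ ⁽ j ⁾ ≈ x ⁽ i ℕ.+ j ⁾
  ⁽⁾-⁽⁾ x i j = trans (^-assocʳ x (q ℕ.^ i) (q ℕ.^ j)) (^-congʳ x (≡.sym (ℕ.^-distribˡ-+-* q i j)))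

  ⁽⁾-^q : ∀ x i → (x ⁽ i ⁾) ^ q ≈ x ⁽ suc i ⁾
  ⁽⁾-^q x i = trans (^-assocʳ x (q ℕ.^ i) q) (^-congʳ x (ℕ.*-comm (q ℕ.^ i) q))

  ^q-⁽⁾ : ∀ x i → (x ^ q) ⁽ i ⁾ ≈ x ⁽ suc i ⁾
  ^q-⁽⁾ x i = ^-assocʳ x q (q ℕ.^ i)

  -- K has q⁵ elements, so five applications of Frobenius give the identity.
  ⁽i+5⁾ : ∀ x i → x ⁽ i ℕ.+ 5 ⁾ ≈ x ⁽ i ⁾
  ⁽i+5⁾ x i = trans (sym (⁽⁾-⁽⁾ x i 5)) (^cardinality (x ⁽ i ⁾))

  ⁽⁾-+ : ∀ i x y → (x + y) ⁽ i ⁾ ≈ x ⁽ i ⁾ + y ⁽ i ⁾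
  ⁽⁾-+ zero    x y = trans (*-identityʳ _) (sym (+-cong (*-identityʳ x) (*-identityʳ y)))
  ⁽⁾-+ (suc i) x y = begin
    (x + y) ⁽ suc i ⁾              ≈⟨ ^q-⁽⁾ (x + y) i ⟨
    ((x + y) ^ q) ⁽ i ⁾            ≈⟨ ⁽⁾-cong i (^q-distrib-+ q-primePower x y) ⟩
    (x ^ q + y ^ q) ⁽ i ⁾          ≈⟨ ⁽⁾-+ i (x ^ q) (y ^ q) ⟩
    (x ^ q) ⁽ i ⁾ + (y ^ q) ⁽ i ⁾  ≈⟨ +-cong (^q-⁽⁾ x i) (^q-⁽⁾ y i) ⟩
    x ⁽ suc i ⁾ + y ⁽ suc i ⁾      ∎

  ⁽⁾-* : ∀ i x y → (x * y) ⁽ i ⁾ ≈ x ⁽ i ⁾ * y ⁽ i ⁾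
  ⁽⁾-* i x y = ^-distrib-* x y (q ℕ.^ i)

  ⁽⁾-fixed : ∀ i {a} → a ^ q ≈ a → a ⁽ i ⁾ ≈ a
  ⁽⁾-fixed zero        a^q≈a = *-identityʳ _
  ⁽⁾-fixed (suc i) {a} a^q≈a = begin
    a ⁽ suc i ⁾    ≈⟨ ^q-⁽⁾ a i ⟨
    (a ^ q) ⁽ i ⁾  ≈⟨ ⁽⁾-cong i a^q≈a ⟩
    a ⁽ i ⁾        ≈⟨ ⁽⁾-fixed i a^q≈a ⟩
    a              ∎

  -- As q is not visibly a successor, 0 is treated as an element of F, fixed by the q-th power.
  0^q≈0 : 0# ^ q ≈ 0#
  0^q≈0 = trans (^-congˡ q (sym 0#-homo)) (trans (ι^q≈ι F.0#) 0#-homo)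

  ⁽⁾-inverse : ∀ i {x y} → x + y ≈ 0# → x ⁽ i ⁾ + y ⁽ i ⁾ ≈ 0#
  ⁽⁾-inverse i {x} {y} x+y≈0 = begin
    x ⁽ i ⁾ + y ⁽ i ⁾  ≈⟨ ⁽⁾-+ i x y ⟨
    (x + y) ⁽ i ⁾      ≈⟨ ⁽⁾-cong i x+y≈0 ⟩
    0# ⁽ i ⁾           ≈⟨ ⁽⁾-fixed i 0^q≈0 ⟩
    0#                 ∎

  ^q-+ : ∀ x y → (x + y) ^ q ≈ x ^ q + y ^ q
  ^q-+ = ^q-distrib-+ q-primePower

  Tr-inverse : ∀ {x y} → x + y ≈ 0# → Tr x + Tr y ≈ 0#
  Tr-inverse {x} {y} x+y≈0 = begin
    Tr x + Tr y
      ≈⟨ solve 10 (λ a b c d e a′ b′ c′ d′ e′ →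
           (a :+ b :+ c :+ d :+ e) :+ (a′ :+ b′ :+ c′ :+ d′ :+ e′) :=
           (a :+ a′) :+ (b :+ b′) :+ (c :+ c′) :+ (d :+ d′) :+ (e :+ e′)) refl
           x (x ^ q) (x ⁽ 2 ⁾) (x ⁽ 3 ⁾) (x ⁽ 4 ⁾) y (y ^ q) (y ⁽ 2 ⁾) (y ⁽ 3 ⁾) (y ⁽ 4 ⁾) ⟩
    (x + y) + (x ^ q + y ^ q) + (x ⁽ 2 ⁾ + y ⁽ 2 ⁾) + (x ⁽ 3 ⁾ + y ⁽ 3 ⁾) + (x ⁽ 4 ⁾ + y ⁽ 4 ⁾)
      ≈⟨ +-cong (+-cong (+-cong (+-cong x+y≈0
           (trans (+-cong (sym (⁽1⁾≈^q x)) (sym (⁽1⁾≈^q y))) (⁽⁾-inverse 1 x+y≈0)))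
           (⁽⁾-inverse 2 x+y≈0)) (⁽⁾-inverse 3 x+y≈0)) (⁽⁾-inverse 4 x+y≈0) ⟩
    0# + 0# + 0# + 0# + 0#
      ≈⟨ solve 0 (con 0 :+ con 0 :+ con 0 :+ con 0 :+ con 0 := con 0) refl ⟩
    0# ∎

  -- The q-th power shifts the five conjugates cyclically, and x₅ = x closes the cycle.
  Tr^q≈Tr : ∀ x → Tr x ^ q ≈ Tr x
  Tr^q≈Tr x = begin
    Tr x ^ q
      ≈⟨ trans (^q-+ _ _) (+-congʳ (trans (^q-+ _ _) (+-congʳ (trans (^q-+ _ _) (+-congʳ (^q-+ _ _)))))) ⟩
    x ^ q + (x ^ q) ^ q + (x ⁽ 2 ⁾) ^ q + (x ⁽ 3 ⁾) ^ q + (x ⁽ 4 ⁾) ^ q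
      ≈⟨ +-cong (+-cong (+-cong (+-congˡ
           (trans (^-congˡ q (sym (⁽1⁾≈^q x))) (⁽⁾-^q x 1))) (⁽⁾-^q x 2)) (⁽⁾-^q x 3))
           (trans (⁽⁾-^q x 4) (^cardinality x)) ⟩
    x ^ q + x ⁽ 2 ⁾ + x ⁽ 3 ⁾ + x ⁽ 4 ⁾ + x
      ≈⟨ solve 5 (λ a b c d e → b :+ c :+ d :+ e :+ a := a :+ b :+ c :+ d :+ e) refl
           x (x ^ q) (x ⁽ 2 ⁾) (x ⁽ 3 ⁾) (x ⁽ 4 ⁾) ⟩
    Tr x ∎

  -- The ring solver has no negation, so identities are stated free of subtraction and signs
  -- are removed by +-cancelʳ.
  module Model (δ : Carrier) (δ^q≈δ : δ ^ q ≈ δ) (δ²+1≈δ : δ * δ + 1# ≈ δ) where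

    -- Membership of η in F_q is encoded as a fixed-point equation inside K, and (1 + 2δ) η is
    -- written out as `η + (δ + δ) * η`.
    M : Pred Vector (c ⊔ ℓ)
    M v = ∃₂ λ x η → η ^ q ≈ η × δ * Tr x + (η + (δ + δ) * η) ≈ 0# × v ≈ᵥ (x , x ^ q + η)

    δ≉0 : ¬ δ ≈ 0#
    δ≉0 δ≈0 = 1≉0 (begin
      1#           ≈⟨ +-identityˡ 1# ⟨
      0# + 1#      ≈⟨ +-congʳ (trans (*-congʳ δ≈0) (zeroˡ δ)) ⟨
      δ * δ + 1#   ≈⟨ δ²+1≈δ ⟩
      δ            ≈⟨ δ≈0 ⟩
      0#           ∎)

    -- On F_q the norm is the fifth power. The relation gives δ³ = -1, hence δ⁵ = -δ² = 1 - δ.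
    N[δ]+δ≈1 : N δ + δ ≈ 1#
    N[δ]+δ≈1 = begin
      N δ + δ                              ≈⟨ +-congʳ N≈ ⟩
      -- Adding δ³ + δ² to both sides lets each reduction use δ² + 1 = δ without subtraction.
      δ * 1# * δ * δ * δ * δ + δ           ≈⟨ +-cancelʳ (δ * δ * δ + δ * δ) _ _ (begin
        δ * 1# * δ * δ * δ * δ + δ + (δ * δ * δ + δ * δ)
          ≈⟨ solve 1 (λ d → d :* con 1 :* d :* d :* d :* d :+ d :+ (d :* d :* d :+ d :* d) :=
                            d :* d :* d :* (d :* d :+ con 1) :+ d :* d :+ d) refl δ ⟩
        δ * δ * δ * (δ * δ + 1#) + δ * δ + δ
          ≈⟨ +-congʳ (+-congʳ (*-congˡ δ²+1≈δ)) ⟩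
        δ * δ * δ * δ + δ * δ + δ
          ≈⟨ solve 1 (λ d → d :* d :* d :* d :+ d :* d :+ d := d :* d :* (d :* d :+ con 1) :+ d) refl δ ⟩
        δ * δ * (δ * δ + 1#) + δ
          ≈⟨ +-cong (*-congˡ δ²+1≈δ) (sym δ²+1≈δ) ⟩
        δ * δ * δ + (δ * δ + 1#)
          ≈⟨ solve 1 (λ d → d :* d :* d :+ (d :* d :+ con 1) := con 1 :+ (d :* d :* d :+ d :* d)) refl δ ⟩
        1# + (δ * δ * δ + δ * δ) ∎) ⟩
      1# ∎
      where
      split : ∀ m n {a b} → δ ^ m ≈ a → δ ^ n ≈ b → δ ^ (m ℕ.+ n) ≈ a * b
      split m n p r = trans (^-homo-* δ m n) (*-cong p r)
      N≈ : N δ ≈ δ * 1# * δ * δ * δ * δ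
      N≈ = split (1 ℕ.+ q ℕ.+ q ℕ.^ 2 ℕ.+ q ℕ.^ 3) (q ℕ.^ 4)
             (split (1 ℕ.+ q ℕ.+ q ℕ.^ 2) (q ℕ.^ 3)
               (split (1 ℕ.+ q) (q ℕ.^ 2)
                 (split 1 q refl δ^q≈δ) (⁽⁾-fixed 2 δ^q≈δ)) (⁽⁾-fixed 3 δ^q≈δ)) (⁽⁾-fixed 4 δ^q≈δ)

    -- A zero norm would force δ = 1, and the relation would then read 1 + 1 = 1.
    N[δ]≉0 : ¬ N δ ≈ 0#
    N[δ]≉0 N≈0 = 1≉0 (+-cancelʳ 1# _ _ (begin
      1# + 1#        ≈⟨ +-congʳ (trans (*-cong δ≈1 δ≈1) (*-identityˡ 1#)) ⟨
      δ * δ + 1#     ≈⟨ δ²+1≈δ ⟩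
      δ              ≈⟨ δ≈1 ⟩
      1#             ≈⟨ +-identityˡ 1# ⟨
      0# + 1#        ∎))
      where
      δ≈1 : δ ≈ 1#
      δ≈1 = trans (sym (+-identityˡ δ)) (trans (+-congʳ (sym N≈0)) N[δ]+δ≈1)

    N[δ]≉1 : ¬ N δ ≈ 1#
    N[δ]≉1 N≈1 = δ≉0 (+-cancelʳ 1# _ _ (begin
      δ + 1#     ≈⟨ +-comm δ 1# ⟩
      1# + δ     ≈⟨ +-congʳ N≈1 ⟨
      N δ + δ    ≈⟨ N[δ]+δ≈1 ⟩
      1#         ≈⟨ +-identityˡ 1# ⟨
      0# + 1#    ∎))

    -- The projectivity from the model space to the linear set of LP type.

    A : GL₂
    A = record
      { a₁₁ = δ ; a₁₂ = 1# ; a₂₁ = - δ ; a₂₂ = - δ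
      ; det≉0 = λ det≈0 → 1≉0 (trans (sym det≈1) det≈0)
      }
      where
      -- The determinant is -δ² + δ, which is 1 by the defining relation of δ.
      det≈1 : δ * - δ - 1# * - δ ≈ 1#
      det≈1 = +-cancelʳ (δ * δ + 1# * - δ) _ _ (begin
        δ * - δ - 1# * - δ + (δ * δ + 1# * - δ)
          ≈⟨ solve 4 (λ d e f g → d :* e :+ f :+ (d :* d :+ g) := d :* (e :+ d) :+ (f :+ g)) refl
               δ (- δ) (- (1# * - δ)) (1# * - δ) ⟩
        δ * (- δ + δ) + (- (1# * - δ) + 1# * - δ)
          ≈⟨ +-cong (trans (*-congˡ (-‿inverseˡ δ)) (zeroʳ δ)) (-‿inverseˡ _) ⟩
        0# + 0#                             ≈⟨ +-identityˡ 0# ⟩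
        0#                                  ≈⟨ -‿inverseʳ δ ⟨
        δ - δ                               ≈⟨ +-congʳ δ²+1≈δ ⟨
        δ * δ + 1# - δ
          ≈⟨ solve 2 (λ d e → d :* d :+ con 1 :+ e := con 1 :+ (d :* d :+ con 1 :* e)) refl δ (- δ) ⟩
        1# + (δ * δ + 1# * - δ)             ∎)

    -- The second coordinate in `LPSet 2 δ`, where 5 ∸ 2 gives the exponent 3.
    LP : Carrier → Carrier
    LP y = y ⁽ 2 ⁾ + δ * y ⁽ 3 ⁾

    LP-cong : ∀ {x y} → x ≈ y → LP x ≈ LP y
    LP-cong x≈y = +-cong (⁽⁾-cong 2 x≈y) (*-congˡ (⁽⁾-cong 3 x≈y))

    LP-0 : LP 0# ≈ 0#
    LP-0 = trans (+-cong (0⁽ 2 ⁾) (trans (*-congˡ 0⁽ 3 ⁾) (zeroʳ δ))) (+-identityˡ 0#)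
      where
      0⁽_⁾ : ∀ i → 0# ⁽ i ⁾ ≈ 0#
      0⁽ i ⁾ = ⁽⁾-fixed i 0^q≈0

    -- For y = δx + x₁ + η the claim is y₂ + δy₃ + δ(x + x₁ + η) = 0. The coefficient of x₃ on the
    -- left is δ² + 1 = δ, so the left side collapses to δ Tr(x) + (1 + 2δ) η.
    apply-A-∈M : ∀ {v} → M v → GL₂.apply A v ≈ᵥ (proj₁ (GL₂.apply A v) , LP (proj₁ (GL₂.apply A v)))
    apply-A-∈M {u , w} (x , η , η^q≈η , rel , u≈x , w≈) = refl , sym (begin
      LP (δ * u + 1# * w)
        ≈⟨ LP-cong (+-cong (*-congˡ u≈x) (trans (*-identityˡ w) w≈)) ⟩
      LP y
        ≈⟨ +-inverseˡ-unique _ _ (begin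
          LP y + (δ * x + δ * (x₁ + η))
            ≈⟨ +-congʳ (+-cong y⁽ 2 ⁾ (*-congˡ y⁽ 3 ⁾)) ⟩
          (δ * x₂ + (x₃ + η)) + δ * (δ * x₃ + (x₄ + η)) + (δ * x + δ * (x₁ + η))
            ≈⟨ solve 7 (λ d x₀ x₁ x₂ x₃ x₄ η →
                 (d :* x₂ :+ (x₃ :+ η)) :+ d :* (d :* x₃ :+ (x₄ :+ η)) :+ (d :* x₀ :+ d :* (x₁ :+ η)) :=
                 (d :* (x₀ :+ x₁ :+ x₂ :+ x₄) :+ (η :+ (d :+ d) :* η)) :+ (d :* d :+ con 1) :* x₃)
                 refl δ x x₁ x₂ x₃ x₄ η ⟩
          δ * (x + x₁ + x₂ + x₄) + (η + (δ + δ) * η) + (δ * δ + 1#) * x₃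
            ≈⟨ +-congˡ (*-congʳ δ²+1≈δ) ⟩
          δ * (x + x₁ + x₂ + x₄) + (η + (δ + δ) * η) + δ * x₃
            ≈⟨ solve 7 (λ d x₀ x₁ x₂ x₃ x₄ η →
                 d :* (x₀ :+ x₁ :+ x₂ :+ x₄) :+ (η :+ (d :+ d) :* η) :+ d :* x₃ :=
                 d :* (x₀ :+ x₁ :+ x₂ :+ x₃ :+ x₄) :+ (η :+ (d :+ d) :* η))
                 refl δ x x₁ x₂ x₃ x₄ η ⟩
          δ * Tr x + (η + (δ + δ) * η)
            ≈⟨ rel ⟩
          0# ∎) ⟩
      - (δ * x + δ * (x₁ + η))
        ≈⟨ -‿+-comm _ _ ⟨
      - (δ * x) + - (δ * (x₁ + η))
        ≈⟨ +-cong (-‿distribˡ-* δ x) (-‿distribˡ-* δ _) ⟩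
      - δ * x + - δ * (x₁ + η)
        ≈⟨ +-cong (*-congˡ u≈x) (*-congˡ w≈) ⟨
      - δ * u + - δ * w ∎)
      where
      x₁ x₂ x₃ x₄ y : Carrier
      x₁ = x ^ q
      x₂ = x ⁽ 2 ⁾
      x₃ = x ⁽ 3 ⁾
      x₄ = x ⁽ 4 ⁾
      y = δ * x + (x₁ + η)
      y⁽_⁾ : ∀ i → y ⁽ i ⁾ ≈ δ * x ⁽ i ⁾ + (x ⁽ suc i ⁾ + η)
      y⁽ i ⁾ = begin
        y ⁽ i ⁾                                           ≈⟨ trans (⁽⁾-+ i _ _) (+-congˡ (⁽⁾-+ i _ _)) ⟩
        (δ * x) ⁽ i ⁾ + ((x ^ q) ⁽ i ⁾ + η ⁽ i ⁾)
          ≈⟨ +-cong (trans (⁽⁾-* i δ x) (*-congʳ (⁽⁾-fixed i δ^q≈δ))) (+-cong (^q-⁽⁾ x i) (⁽⁾-fixed i η^q≈η)) ⟩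
        δ * x ⁽ i ⁾ + (x ⁽ suc i ⁾ + η)                   ∎

    apply-A-surjective : ∀ y → ∃ λ v → M v × proj₁ (GL₂.apply A v) ≈ y
    apply-A-surjective y = (x , x ^ q + η) , (x , η , η^q≈η , rel , refl , refl) , (+-cancelʳ n _ _ (begin
      δ * x + 1# * (x ^ q + η) + n
        ≈⟨ +-congʳ (+-congˡ (*-congˡ (+-congʳ x₁))) ⟩
      δ * (δ * n + n₂ + δ * n₃) + 1# * (δ * n₁ + n₃ + δ * n₄ + δ * Tr y) + n
        ≈⟨ solve 7 (λ d n n₁ n₂ n₃ n₄ t →
             d :* (d :* n :+ n₂ :+ d :* n₃) :+ con 1 :* (d :* n₁ :+ n₃ :+ d :* n₄ :+ d :* t) :+ n :=
             (d :* d :+ con 1) :* (n :+ n₃) :+ d :* (n₁ :+ n₂ :+ n₄ :+ t)) refl δ n n₁ n₂ n₃ n₄ (Tr y) ⟩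
      (δ * δ + 1#) * (n + n₃) + δ * (n₁ + n₂ + n₄ + Tr y)
        ≈⟨ +-congʳ (*-congʳ δ²+1≈δ) ⟩
      δ * (n + n₃) + δ * (n₁ + n₂ + n₄ + Tr y)
        ≈⟨ solve 7 (λ d n n₁ n₂ n₃ n₄ t →
             d :* (n :+ n₃) :+ d :* (n₁ :+ n₂ :+ n₄ :+ t) :=
             d :* ((n :+ n₁ :+ n₂ :+ n₃ :+ n₄) :+ t)) refl δ n n₁ n₂ n₃ n₄ (Tr y) ⟩
      δ * (Tr n + Tr y)
        ≈⟨ *-congˡ Trn+Try≈0 ⟩
      δ * 0#     ≈⟨ zeroʳ δ ⟩
      0#         ≈⟨ -‿inverseʳ y ⟨
      y + n      ∎))
      where
      n n₁ n₂ n₃ n₄ x η : Carrier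
      -- The inverse of A is (-δ -1 ; δ δ). Applied to (y, y₂ + δy₃), it gives x as first
      -- coordinate, and subtracting x₁ from the second leaves δ Tr(y) = η. Writing n for -y keeps
      -- the formulas free of signs.
      n = - y
      n₁ = n ^ q
      n₂ = n ⁽ 2 ⁾
      n₃ = n ⁽ 3 ⁾
      n₄ = n ⁽ 4 ⁾
      x = δ * n + n₂ + δ * n₃
      η = δ * Tr y

      η^q≈η : η ^ q ≈ η
      η^q≈η = trans (^-distrib-* δ (Tr y) q) (*-cong δ^q≈δ (Tr^q≈Tr y))

      Trn+Try≈0 : Tr n + Tr y ≈ 0#
      Trn+Try≈0 = Tr-inverse (-‿inverseˡ y)

      x⁽_⁾ : ∀ i → x ⁽ i ⁾ ≈ δ * n ⁽ i ⁾ + n ⁽ 2 ℕ.+ i ⁾ + δ * n ⁽ 3 ℕ.+ i ⁾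
      x⁽ i ⁾ = trans (⁽⁾-+ i _ _) (+-cong
        (trans (⁽⁾-+ i _ _) (+-cong (δ*⁽⁾ n) (⁽⁾-⁽⁾ n 2 i)))
        (trans (δ*⁽⁾ n₃) (*-congˡ (⁽⁾-⁽⁾ n 3 i))))
        where
        δ*⁽⁾ : ∀ z → (δ * z) ⁽ i ⁾ ≈ δ * z ⁽ i ⁾
        δ*⁽⁾ z = trans (⁽⁾-* i δ z) (*-congʳ (⁽⁾-fixed i δ^q≈δ))

      n₅ : n ⁽ 5 ⁾ ≈ n
      n₅ = ^cardinality n
      n₆ : n ⁽ 6 ⁾ ≈ n₁
      n₆ = trans (⁽i+5⁾ n 1) (⁽1⁾≈^q n)
      n₇ : n ⁽ 7 ⁾ ≈ n₂
      n₇ = ⁽i+5⁾ n 2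

      x₁ : x ^ q ≈ δ * n₁ + n₃ + δ * n₄
      x₁ = trans (sym (⁽1⁾≈^q x)) (trans x⁽ 1 ⁾ (+-congʳ (+-congʳ (*-congˡ (⁽1⁾≈^q n)))))
      x₂ : x ⁽ 2 ⁾ ≈ δ * n₂ + n₄ + δ * n
      x₂ = trans x⁽ 2 ⁾ (+-congˡ (*-congˡ n₅))
      x₃ : x ⁽ 3 ⁾ ≈ δ * n₃ + n + δ * n₁
      x₃ = trans x⁽ 3 ⁾ (+-cong (+-congˡ n₅) (*-congˡ n₆))
      x₄ : x ⁽ 4 ⁾ ≈ δ * n₄ + n₁ + δ * n₂
      x₄ = trans x⁽ 4 ⁾ (+-cong (+-congˡ n₆) (*-congˡ n₇))

      -- Over the five conjugates of x, each conjugate of n collects the coefficient δ + 1 + δ.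
      Tr-x : Tr x ≈ (1# + (δ + δ)) * Tr n
      Tr-x = begin
        Tr x
          ≈⟨ +-cong (+-cong (+-cong (+-congˡ x₁) x₂) x₃) x₄ ⟩
        (δ * n + n₂ + δ * n₃) + (δ * n₁ + n₃ + δ * n₄) + (δ * n₂ + n₄ + δ * n) +
        (δ * n₃ + n + δ * n₁) + (δ * n₄ + n₁ + δ * n₂)
          ≈⟨ solve 6 (λ d n n₁ n₂ n₃ n₄ →
               (d :* n :+ n₂ :+ d :* n₃) :+ (d :* n₁ :+ n₃ :+ d :* n₄) :+ (d :* n₂ :+ n₄ :+ d :* n) :+
               (d :* n₃ :+ n :+ d :* n₁) :+ (d :* n₄ :+ n₁ :+ d :* n₂) :=
               (con 1 :+ (d :+ d)) :* (n :+ n₁ :+ n₂ :+ n₃ :+ n₄)) refl δ n n₁ n₂ n₃ n₄ ⟩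
        (1# + (δ + δ)) * Tr n ∎

      -- Both terms share the factor δ(1 + 2δ), leaving Tr(n) + Tr(y) = 0.
      rel : δ * Tr x + (η + (δ + δ) * η) ≈ 0#
      rel = begin
        δ * Tr x + (η + (δ + δ) * η)
          ≈⟨ +-congʳ (*-congˡ Tr-x) ⟩
        δ * ((1# + (δ + δ)) * Tr n) + (δ * Tr y + (δ + δ) * (δ * Tr y))
          ≈⟨ solve 3 (λ d s t → d :* ((con 1 :+ (d :+ d)) :* s) :+ (d :* t :+ (d :+ d) :* (d :* t)) :=
                                d :* (con 1 :+ (d :+ d)) :* (s :+ t)) refl δ (Tr n) (Tr y) ⟩
        δ * (1# + (δ + δ)) * (Tr n + Tr y)
          ≈⟨ *-congˡ Trn+Try≈0 ⟩
        δ * (1# + (δ + δ)) * 0#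
          ≈⟨ zeroʳ _ ⟩
        0# ∎

    -- A sends M onto the graph of `LP` and commutes with scalars, so spanned points correspond to
    -- spanned points.
    L[M]-isLPType : ∀ {a} {U : Pred Vector a} → U ≐ M → IsLPType (L U)
    L[M]-isLPType {U = U} (U⊆M , M⊆U) =
      2 , δ , s≤s z≤n , s≤s (s≤s (s≤s z≤n)) , N[δ]≉0 , N[δ]≉1 , A ,
      (λ {Q} → image⊆LP {Q}) , (λ {Q} → LP⊆image {Q})
      where
      open GL₂ A using (apply)

      image⊆LP : image A (L U) ⊆ LPSet 2 δ
      image⊆LP {Q} (P , (u , u∈U , u≉0 , k , k≉0 , p₁ , p₂) , l , l≉0 , r₁ , r₂) =
        -- Here P is k times u and Q is l times the image of P, so Q is l * k times the image of u.
        proj₁ (apply u) , y≉0 , l * k , *-nonzero l≉0 k≉0 ,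
        trans r₁ (scale δ 1# refl) ,
        trans r₂ (scale (- δ) (- δ) (proj₂ (apply-A-∈M (U⊆M u∈U))))
        where
        scale : ∀ a b {z} → a * proj₁ u + b * proj₂ u ≈ z →
                l * (a * proj₁ (vector P) + b * proj₂ (vector P)) ≈ l * k * z
        scale a b {z} au≈z = begin
          l * (a * proj₁ (vector P) + b * proj₂ (vector P))
            ≈⟨ *-congˡ (+-cong (*-congˡ p₁) (*-congˡ p₂)) ⟩
          l * (a * (k * proj₁ u) + b * (k * proj₂ u))
            ≈⟨ solve 6 (λ l k a b u v → l :* (a :* (k :* u) :+ b :* (k :* v)) :=
                                        l :* k :* (a :* u :+ b :* v)) refl l k a b (proj₁ u) (proj₂ u) ⟩
          l * k * (a * proj₁ u + b * proj₂ u)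
            ≈⟨ *-congˡ au≈z ⟩
          l * k * z ∎
        -- On the graph of `LP` a zero first coordinate makes the whole vector zero, against the
        -- invertibility of A.
        y≉0 : ¬ proj₁ (apply u) ≈ 0#
        y≉0 y≈0 = apply-nonzero A u≉0
          (y≈0 , trans (proj₂ (apply-A-∈M (U⊆M u∈U))) (trans (LP-cong y≈0) LP-0))

      LP⊆image : LPSet 2 δ ⊆ image A (L U)
      LP⊆image {Q} (y , y≉0 , k , k≉0 , p₁ , p₂) =
        ⟨ v , v≉0 ⟩ ,
        (v , M⊆U v∈M , v≉0 , 1# , 1≉0 , sym (*-identityˡ (proj₁ v)) , sym (*-identityˡ (proj₂ v))) ,
        k , k≉0 , trans p₁ (*-congˡ (sym v↦y)) ,
        trans p₂ (*-congˡ (sym (trans (proj₂ (apply-A-∈M v∈M)) (LP-cong v↦y))))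
        where
        v : Vector
        v = proj₁ (apply-A-surjective y)
        v∈M : M v
        v∈M = proj₁ (proj₂ (apply-A-surjective y))
        v↦y : proj₁ (apply v) ≈ y
        v↦y = proj₂ (proj₂ (apply-A-surjective y))
        v≉0 : ¬ v ≈ᵥ 0ᵥ
        v≉0 (v₁≈0 , v₂≈0) = y≉0 (trans (sym v↦y) (trans
          (+-cong (trans (*-congˡ v₁≈0) (zeroʳ δ)) (trans (*-congˡ v₂≈0) (zeroʳ 1#))) (+-identityˡ 0#)))

-- Roots of X² - X + 1, the sixth cyclotomic polynomial.

module SixthRootsOfUnity {c ℓ} (R : CommutativeRing c ℓ) where
  open CommutativeRing R
  open Mult semiring using (×-congʳ) renaming (_×_ to _·_)
  open Exp commutativeSemiring using (_^_)
  open RingProperties ring using (+-cancelʳ)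
  open Solver commutativeSemiring
  open SetoidReasoning setoid

  3²+1≈3 : 7 · 1# ≈ 0# → 3 · 1# * 3 · 1# + 1# ≈ 3 · 1#
  3²+1≈3 7·1≈0 = begin
    3 · 1# * 3 · 1# + 1#    ≈⟨ solve 0 (3 :× con 1 :* 3 :× con 1 :+ con 1 := 3 :× con 1 :+ 7 :× con 1) refl ⟩
    3 · 1# + 7 · 1#         ≈⟨ +-congˡ 7·1≈0 ⟩
    3 · 1# + 0#             ≈⟨ +-identityʳ _ ⟩
    3 · 1#                  ∎

  1+2·3≈0 : 7 · 1# ≈ 0# → 1# + (3 · 1# + 3 · 1#) ≈ 0#
  1+2·3≈0 7·1≈0 = trans (solve 0 (con 1 :+ (3 :× con 1 :+ 3 :× con 1) := 7 :× con 1) refl) 7·1≈0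

  module _ (γ : Carrier) (γ-root : 7 · (γ ^ 2) + 5 · γ + 1# ≈ 0#) where
    private
      e r : Carrier
      e = 7 · γ + 2 · 1#
      r = 7 · (γ ^ 2) + 5 · γ + 1#
      -- These are the solver's polynomial counterparts of `e` and `r`.
      ẽ r̃ : ∀ {n} → Polynomial n → Polynomial n
      ẽ g = 7 :× g :+ 2 :× con 1
      r̃ g = 7 :× (g :^ 2) :+ 5 :× g :+ con 1

    -- Solving γ(1 + 2δ) = −δ gives δ = −γ/(1 + 2γ), and (1 + 2γ)(14γ + 3) = −1;
    -- hence δ = γ(14γ + 3) = −(7γ + 2).
    δ : Carrier
    δ = - e

    -- With δ = -e the claim is e² + e + 1 = 0, and e² + e + 1 = 7r identically in γ.
    δ²+1≈δ : δ * δ + 1# ≈ δ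
    δ²+1≈δ = +-cancelʳ (e * (δ + e) + e) _ _ (begin
      δ * δ + 1# + (e * (δ + e) + e)
        ≈⟨ solve 2 (λ g d → d :* d :+ con 1 :+ (ẽ g :* (d :+ ẽ g) :+ ẽ g) :=
                            d :* (d :+ ẽ g) :+ 7 :× r̃ g) refl γ δ ⟩
      δ * (δ + e) + 7 · r
        ≈⟨ +-cong (trans (*-congˡ (-‿inverseˡ e)) (zeroʳ δ)) (×-congʳ 7 γ-root) ⟩
      0# + 7 · 0#
        ≈⟨ solve 1 (λ e → con 0 :+ 7 :× con 0 := e :* con 0 :+ con 0) refl e ⟩
      e * 0# + 0#
        ≈⟨ +-cong (*-congˡ (-‿inverseˡ e)) (-‿inverseˡ e) ⟨
      e * (δ + e) + (δ + e)
        ≈⟨ solve 2 (λ d e → e :* (d :+ e) :+ (d :+ e) := d :+ (e :* (d :+ e) :+ e)) refl δ e ⟩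
      δ + (e * (δ + e) + e) ∎)

    -- Substituting δ = -(7γ + 2) turns the left side into -2r.
    γ[1+2δ]+δ≈0 : γ * (1# + (δ + δ)) + δ ≈ 0#
    γ[1+2δ]+δ≈0 = +-cancelʳ (γ + 2 · r) _ _ (begin
      γ * (1# + (δ + δ)) + δ + (γ + 2 · r)
        ≈⟨ solve 2 (λ g d → g :* (con 1 :+ (d :+ d)) :+ d :+ (g :+ 2 :× r̃ g) :=
                            (2 :× g :+ con 1) :* (d :+ ẽ g) :+ g) refl γ δ ⟩
      (2 · γ + 1#) * (δ + e) + γ
        ≈⟨ +-congʳ (trans (*-congˡ (-‿inverseˡ e)) (zeroʳ _)) ⟩
      0# + γ
        ≈⟨ solve 1 (λ g → con 0 :+ g := con 0 :+ (g :+ 2 :× con 0)) refl γ ⟩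
      0# + (γ + 2 · 0#)
        ≈⟨ +-congˡ (+-congˡ (×-congʳ 2 γ-root)) ⟨
      0# + (γ + 2 · r) ∎)

-- Identification of the two given subspaces with the model.

module SpecialCases {c ℓ q} (q-primePower : IsPrimePower q) (E : FiniteFieldExtension c ℓ q 5) where
  open FiniteFieldExtension E
  open K
  open LinearSets E
  open ExtensionProperties E
  open LPType q-primePower E
  open Exp commutativeSemiring using (^-distrib-*)
  open FieldProperties asField using (*-cancelˡ-nonzero)
  open SixthRootsOfUnity
  open Solver commutativeSemiring

  private
    ι-quadratic : ∀ {d} → d F.* d F.+ F.1# F.≈ d → ι d * ι d + 1# ≈ ι d
    ι-quadratic {d} d²+1≈d = begin
      ι d * ι d + 1#          ≈⟨ +-cong (*-homo d d) 1#-homo ⟨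
      ι (d F.* d) + ι F.1#    ≈⟨ +-homo _ _ ⟨
      ι (d F.* d F.+ F.1#)    ≈⟨ ι-cong d²+1≈d ⟩
      ι d                     ∎
      where open SetoidReasoning setoid

    ι-1+2 : ∀ d → ι (F.1# F.+ (d F.+ d)) ≈ 1# + (ι d + ι d)
    ι-1+2 d = trans (+-homo _ _) (+-cong 1#-homo (+-homo d d))

  module Char7 (7·1≈0 : 7 F.· F.1# F.≈ F.0#) (γ : F.Carrier) (γ≉0 : ¬ γ F.≈ F.0#) where

    d : F.Carrier
    d = 3 F.· F.1#

    open Model (ι d) (ι^q≈ι d) (ι-quadratic (3²+1≈3 F.commutativeRing 7·1≈0))
    open SetoidReasoning setoid

    1+2δ≈0 : 1# + (ι d + ι d) ≈ 0#
    1+2δ≈0 = begin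
      1# + (ι d + ι d)            ≈⟨ ι-1+2 d ⟨
      ι (F.1# F.+ (d F.+ d))      ≈⟨ ι-cong (1+2·3≈0 F.commutativeRing 7·1≈0) ⟩
      ι F.0#                      ≈⟨ 0#-homo ⟩
      0#                          ∎

    -- As 1 + 2δ = 7 = 0, the parameter η drops out and only the trace condition remains.
    relation : ∀ x η → ι d * Tr x + (η + (ι d + ι d) * η) ≈ ι d * Tr x
    relation x η = begin
      ι d * Tr x + (η + (ι d + ι d) * η)
        ≈⟨ solve 3 (λ d t η → d :* t :+ (η :+ (d :+ d) :* η) := d :* t :+ (con 1 :+ (d :+ d)) :* η)
             refl (ι d) (Tr x) η ⟩
      ι d * Tr x + (1# + (ι d + ι d)) * η   ≈⟨ +-congˡ (trans (*-congʳ 1+2δ≈0) (zeroˡ η)) ⟩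
      ι d * Tr x + 0#                       ≈⟨ +-identityʳ _ ⟩
      ι d * Tr x                            ∎

    W⁰≐M : W 0F γ ≐ M
    W⁰≐M = W⊆M , M⊆W
      where
      W⊆M : W 0F γ ⊆ M
      W⊆M (x , h , Trx≈0 , v≈) = x , ι γ * ι h ,
        trans (^-distrib-* (ι γ) (ι h) q) (*-cong (ι^q≈ι γ) (ι^q≈ι h)) ,
        trans (relation x _) (trans (*-congˡ Trx≈0) (zeroʳ _)) , v≈

      M⊆W : M ⊆ W 0F γ
      -- The fixed element η comes from some b in F, and h = γ⁻¹ b then satisfies γh = b.
      M⊆W (x , η , η^q≈η , rel , v₁≈ , v₂≈) = x , γ⁻¹ F.* b ,
        cancel-nonzero δ≉0 (trans (sym (relation x η)) rel) ,
        v₁≈ , trans v₂≈ (+-congˡ (begin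
          η                        ≈⟨ ιb≈η ⟨
          ι b                      ≈⟨ ι-cong (F.*-identityˡ b) ⟨
          ι (F.1# F.* b)           ≈⟨ ι-cong (F.*-congʳ γγ⁻¹≈1) ⟨
          ι (γ F.* γ⁻¹ F.* b)      ≈⟨ ι-cong (F.*-assoc γ γ⁻¹ b) ⟩
          ι (γ F.* (γ⁻¹ F.* b))    ≈⟨ *-homo γ _ ⟩
          ι γ * ι (γ⁻¹ F.* b)      ∎))
        where
        γ⁻¹ b : F.Carrier
        γ⁻¹ = proj₁ (F.inverse γ γ≉0)
        b = proj₁ (fixed⇒∈ι η η^q≈η)
        γγ⁻¹≈1 : γ F.* γ⁻¹ F.≈ F.1#
        γγ⁻¹≈1 = proj₂ (F.inverse γ γ≉0)
        ιb≈η : ι b ≈ η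
        ιb≈η = proj₂ (fixed⇒∈ι η η^q≈η)

    isLPType : IsLPType (L (W 0F γ))
    isLPType = L[M]-isLPType W⁰≐M

  module Quadratic (γ : F.Carrier)
    (γ-root : 7 F.· (γ F.^ 2) F.+ 5 F.· γ F.+ F.1# F.≈ F.0#) where

    d : F.Carrier
    d = δ F.commutativeRing γ γ-root

    open Model (ι d) (ι^q≈ι d) (ι-quadratic (δ²+1≈δ F.commutativeRing γ γ-root))
    open SetoidReasoning setoid

    ι-relation : ι γ * (1# + (ι d + ι d)) + ι d ≈ 0#
    ι-relation = begin
      ι γ * (1# + (ι d + ι d)) + ι d
        ≈⟨ +-congʳ (*-congˡ (ι-1+2 d)) ⟨
      ι γ * ι (F.1# F.+ (d F.+ d)) + ι d
        ≈⟨ +-congʳ (*-homo _ _) ⟨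
      ι (γ F.* (F.1# F.+ (d F.+ d))) + ι d
        ≈⟨ +-homo _ _ ⟨
      ι (γ F.* (F.1# F.+ (d F.+ d)) F.+ d)
        ≈⟨ ι-cong (γ[1+2δ]+δ≈0 F.commutativeRing γ γ-root) ⟩
      ι F.0#
        ≈⟨ 0#-homo ⟩
      0# ∎

    W¹≐M : W 1F γ ≐ M
    W¹≐M = W⊆M , M⊆W
      where
      W⊆M : W 1F γ ⊆ M
      W⊆M (x , v≈) = x , ι γ * Tr x ,
        trans (^-distrib-* (ι γ) (Tr x) q) (*-cong (ι^q≈ι γ) (Tr^q≈Tr x)) ,
        trans (solve 3 (λ d g t → d :* t :+ (g :* t :+ (d :+ d) :* (g :* t)) :=
                                  (g :* (con 1 :+ (d :+ d)) :+ d) :* t) refl (ι d) (ι γ) (Tr x))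
              (trans (*-congʳ ι-relation) (zeroˡ _)) , v≈

      M⊆W : M ⊆ W 1F γ
      -- Multiplying the relation of M by γ and using γ(1 + 2δ) = -δ gives δη = δγ Tr(x), and δ
      -- cancels.
      M⊆W (x , η , η^q≈η , rel , v₁≈ , v₂≈) = x , v₁≈ , trans v₂≈ (+-congˡ (*-cancelˡ-nonzero δ≉0 (begin
        ι d * η
          ≈⟨ +-identityˡ _ ⟨
        0# + ι d * η
          ≈⟨ +-congʳ (trans (*-congˡ rel) (zeroʳ _)) ⟨
        ι γ * (ι d * Tr x + (η + (ι d + ι d) * η)) + ι d * η
          ≈⟨ solve 4 (λ d g t η →
               g :* (d :* t :+ (η :+ (d :+ d) :* η)) :+ d :* η :=
               (g :* (con 1 :+ (d :+ d)) :+ d) :* η :+ d :* (g :* t)) refl (ι d) (ι γ) (Tr x) η ⟩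
        (ι γ * (1# + (ι d + ι d)) + ι d) * η + ι d * (ι γ * Tr x)
          ≈⟨ +-congʳ (trans (*-congʳ ι-relation) (zeroˡ η)) ⟩
        0# + ι d * (ι γ * Tr x)
          ≈⟨ +-identityˡ _ ⟩
        ι d * (ι γ * Tr x) ∎)))

    isLPType : IsLPType (L (W 1F γ))
    isLPType = L[M]-isLPType W¹≐M

proposition2p2 : ∀ {c ℓ} (q : ℕ) → IsPrimePower q →
    (E : FiniteFieldExtension c ℓ q 5) →
    let open FiniteFieldExtension E using (module F)
        open F
        open LinearSets E
    in
    (γ : F.Carrier) → ¬ γ ≈ 0# →
    (ε : Fin 2) →
    (ε ≡ 0F × HasCharacteristic 7) ⊎ (ε ≡ 1F × 7 · (γ ^ 2) + 5 · γ + 1# ≈ 0#) →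
    IsLPType (L (W ε γ))
proposition2p2 q q-primePower E γ γ≉0 ε (inj₁ (≡.refl , 7·1≈0 , _)) =
  SpecialCases.Char7.isLPType q-primePower E 7·1≈0 γ γ≉0
proposition2p2 q q-primePower E γ γ≉0 ε (inj₂ (≡.refl , γ-root)) =
  SpecialCases.Quadratic.isLPType q-primePower E γ γ-root
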